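{- Let $\mathcal C$ be a nowhere dense class of graphs. Then for every $r>0$ there are $\ell,m>0$ such that for every $G\in\mathcal C$, Splitter wins the $(\ell,m,r)$-splitter game on $G$. If $\mathcal C$ is effectively nowhere dense, then $\ell$ and $m$ can be computed from $r$.
   Context: Graphs are finite, simple, undirected. $N_r^G(v)$ denotes the set of vertices at distance at most $r$ from $v$ in $G$; $G[X]$ is the induced subgraph on $X$. A graph $H$ is a depth-$r$ minor of $G$ if there are pairwise vertex-disjoint subgraphs $T_v\subseteq G$ ($v\in V(H)$), each a tree of radius at most $r$, such that for every edge $\{u,v\}\in E(H)$ some edge of $G$ joins $T_u$ and $T_v$. A class $\mathcal C$ is nowhere dense if for every $r$ there is a graph $H_r$ that is not a depth-$r$ minor of any $G\in\mathcal C$; it is effectively nowhere dense if there is a computable function $f$ such that the complete graph $K_{f(r)}$ is not a depth-$r$ minor of any $G\in\mathcal C$, for all $r$. The $(\ell,m,r)$-splitter game on a graph $G$ is played by Connector and Splitter. Let $G_0:=G$. In round $i+1$, Connector chooses a vertex $v_{i+1}\in V(G_i)$; then Splitter chooses a set $W_{i+1}\subseteq N_r^{G_i}(v_{i+1})$ with $|W_{i+1}|\le m$, and $G_{i+1}:=G_i[N_r^{G_i}(v_{i+1})\setminus W_{i+1}]$. Splitter wins if $G_{i+1}$ is empty; otherwise play continues. If Splitter has not won after $\ell$ rounds, Connector wins. A strategy for Splitter maps each partial play together with Connector's next move to a legal answer; it is winning if Splitter wins every play consistent with it; Splitter wins the game on $G$ if he has a winning strategy. -}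

module Defs where

open import Data.Nat using (ℕ; zero; suc; _≤_; _<_)
open import Data.Fin using (Fin; _≟_)
open import Data.Bool using (Bool; true; false; not)
open import Data.Product using (Σ; _×_; _,_; proj₁; proj₂)
open import Data.Sum using (_⊎_)
open import Data.Empty using (⊥; ⊥-elim)
open import Data.Unit using (⊤)
open import Data.List using (List; length)
open import Data.List.Relation.Unary.All using (All)
open import Data.List.Membership.Propositional using (_∈_)
open import Relation.Nullary using (¬_; yes; no)
open import Relation.Nullary.Decidable using (⌊_⌋)
open import Relation.Binary.PropositionalEquality using (_≡_; _≢_; refl; sym; cong)

record Graph : Set where
  field
    n      : ℕ
    adj    : Fin n → Fin n → Bool
    adj-sym    : ∀ i j → adj i j ≡ adj j i
    adj-irrefl : ∀ i → adj i i ≡ false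

open Graph public

Adj : (G : Graph) → Fin (n G) → Fin (n G) → Set
Adj G u w = adj G u w ≡ true

Class : Set₁
Class = Graph → Set

private
  ≟-refl : ∀ {k} (i : Fin k) → ⌊ i ≟ i ⌋ ≡ true
  ≟-refl i with i ≟ i
  ... | yes _ = refl
  ... | no ¬p = ⊥-elim (¬p refl)

  ≟-sym : ∀ {k} (i j : Fin k) → ⌊ i ≟ j ⌋ ≡ ⌊ j ≟ i ⌋
  ≟-sym i j with i ≟ j | j ≟ i
  ... | yes _ | yes _ = refl
  ... | no _  | no _  = refl
  ... | yes p | no ¬q = ⊥-elim (¬q (sym p))
  ... | no ¬p | yes q = ⊥-elim (¬p (sym q))

complete : ℕ → Graph
complete k = record
  { n      = k
  ; adj    = λ i j → not ⌊ i ≟ j ⌋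
  ; adj-sym    = λ i j → cong not (≟-sym i j)
  ; adj-irrefl = λ i → cong not (≟-refl i)
  }

-- Trees of radius at most r in G, presented as rooted trees (rooted at a
-- centre) via a parent function: the tree edges are {u , parent u} for
-- u ≠ root in the vertex set, and every vertex has depth ≤ r.

record RadiusTree (G : Graph) (r : ℕ) : Set where
  field
    mem       : Fin (n G) → Bool
    root      : Fin (n G)
    root∈     : mem root ≡ true
    depth     : Fin (n G) → ℕ
    parent    : Fin (n G) → Fin (n G)
    depthRoot : depth root ≡ 0
    depth≤r   : ∀ u → mem u ≡ true → depth u ≤ r
    parentOk  : ∀ u → mem u ≡ true → u ≢ root →
                (mem (parent u) ≡ true) × Adj G u (parent u)
                × (depth u ≡ suc (depth (parent u)))

open RadiusTree public

record DepthMinor (r : ℕ) (H G : Graph) : Set where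
  field
    branch   : Fin (n H) → RadiusTree G r
    disjoint : ∀ a b u → a ≢ b → mem (branch a) u ≡ true →
               mem (branch b) u ≡ false
    edges    : ∀ a b → Adj H a b →
               Σ (Fin (n G)) λ u → Σ (Fin (n G)) λ w →
                 (mem (branch a) u ≡ true) × (mem (branch b) w ≡ true)
                 × Adj G u w

NowhereDense : Class → Set
NowhereDense 𝒞 = ∀ (r : ℕ) → Σ Graph λ H → ∀ G → 𝒞 G → ¬ DepthMinor r H G

-- every Agda function ℕ → ℕ is computable
EffectivelyNowhereDense : Class → Set
EffectivelyNowhereDense 𝒞 =
  Σ (ℕ → ℕ) λ f → ∀ (r : ℕ) → ∀ G → 𝒞 G → ¬ DepthMinor r (complete (f r)) G

-- Splitter game.  Positions are induced subgraphs G[S], S : Fin n → Set.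

Arena : Graph → Set₁
Arena G = Fin (n G) → Set

data Walk (G : Graph) (S : Arena G) (v : Fin (n G)) : Fin (n G) → ℕ → Set where
  here : S v → Walk G S v v 0
  step : ∀ {u w k} → Walk G S v u k → S w → Adj G u w → Walk G S v w (suc k)

Ball : (G : Graph) → Arena G → Fin (n G) → ℕ → Arena G
Ball G S v r u = Σ ℕ λ k → (k ≤ r) × Walk G S v u k

next : (G : Graph) → Arena G → Fin (n G) → ℕ → List (Fin (n G)) → Arena G
next G S v r W u = Ball G S v r u × ¬ (u ∈ W)

Empty : (G : Graph) → Arena G → Set
Empty G S = ∀ u → ¬ S u

SplitterWinsFrom : (G : Graph) → ℕ → ℕ → ℕ → Arena G → Set
SplitterWinsFrom G zero    m r S = ⊥
SplitterWinsFrom G (suc ℓ) m r S =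
  ∀ v → S v →
    Σ (List (Fin (n G))) λ W →
      (length W ≤ m) × All (λ w → Ball G S v r w) W
      × (Empty G (next G S v r W) ⊎ SplitterWinsFrom G ℓ m r (next G S v r W))

SplitterWins : Graph → ℕ → ℕ → ℕ → Set
SplitterWins G ℓ m r = SplitterWinsFrom G ℓ m r (λ _ → ⊤)

{-# OPTIONS --safe #-}
module Submission where

-- Splitter answers the centre of round b by deleting, for every earlier round a,
-- the vertices of a path from centre a to centre b inside the arena of round a.
-- Then the paths of rounds a < b and c < d are disjoint whenever b < c.  After
-- many rounds, Ramsey's theorem for quadruples of rounds makes the coincidences
-- between the u-th vertices F a b u of the paths (counted from centre b) depend
-- only on the order of the indices.  Let t be the first u for which F a b u does
-- not depend on b; as F a b 0 is centre b and F a b r is centre a, 0 < t ≤ r.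
-- Choose rows j < N and columns i₀ < ... < i_{N-1} beyond them.  The sets
--   { F j i_c u | j < N, u < t } ∪ { F c i_c t }      (c < N)
-- have radius at most r around centre i_c, are pairwise disjoint, since moving one
-- column index alone would otherwise show that F a b u does not depend on b for
-- some u < t, and are pairwise adjacent, since F d i_c t = F d i_d t.  So a long
-- play yields a depth-r minor K_N.

open import Defs
open import Data.Nat using (ℕ; zero; suc; _+_; _*_; _≤_; _<_; z≤n; s≤s; s<s; s≤s⁻¹; s<s⁻¹; _<?_; _≟_)
open import Data.Nat.Properties
  using (≤-refl; ≤-trans; ≤-reflexive; ≤-total; <-trans; <-≤-trans; ≤-<-trans; <⇒≤; <-cmp; ≮⇒≥; n<1+n; m<n⇒m<1+n;
         m<1+n⇒m<n∨m≡n; m≤m+n; m≤n+m; +-suc; +-comm; +-identityʳ; +-mono-≤; +-monoʳ-≤; *-monoˡ-≤;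
         <⇒≢; n≤1+n; ≤-antisym; anyUpTo?)
open import Data.Fin using (Fin; toℕ)
open import Data.Fin.Properties using (any?; toℕ<n; toℕ-injective) renaming (_≟_ to _≟F_)
open import Data.Bool using (Bool; true; false) renaming (_≟_ to _≟B_)
open import Data.Product using (Σ; ∃-syntax; _×_; _,_; proj₁; proj₂)
open import Data.Sum using (_⊎_; inj₁; inj₂; [_,_]′)
open import Data.Unit using (⊤; tt)
open import Data.List using (List; []; _∷_; length; map; filter; drop; upTo; cartesianProduct; cartesianProductWith)
open import Data.List.Properties using (length-map; length-++; length-upTo; length-filter)
open import Data.List.Relation.Unary.All as All using (All; []; _∷_)
open import Data.List.Relation.Unary.All.Properties using (all-filter; all-upTo)
open import Data.List.Relation.Unary.Any using (here; there)
open import Data.List.Relation.Unary.AllPairs using (AllPairs; []; _∷_)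
import Data.List.Relation.Unary.AllPairs.Properties as AllPairs
open import Data.List.Membership.Propositional using (_∈_)
open import Data.List.Membership.DecPropositional using (_∈?_)
open import Data.List.Membership.Propositional.Properties
  using (∈-filter⁺; ∈-upTo⁺; ∈-cartesianProductWith⁺; ∈-cartesianProduct⁺)
open import Data.List.Relation.Binary.Sublist.Propositional using (_⊆_; []; _∷_; _∷ʳ_; ⊆-refl; ⊆-trans; minimum)
open import Data.List.Relation.Binary.Sublist.Propositional.Properties using (All-resp-⊆; drop-⊆)
open import Function using (_∘_; id)
open import Relation.Nullary using (¬_; Dec; yes; no; does; contradiction)
open import Relation.Nullary.Decidable using (True; toWitness; dec-true; dec-false; _×-dec_; _⊎-dec_; map′; ¬?)
open import Relation.Unary using (Decidable)
open import Relation.Binary.Definitions using (tri<; tri≈; tri>)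
open import Relation.Binary.PropositionalEquality using (_≡_; _≢_; refl; sym; trans; cong; cong₂; subst)

does⇒ : {A : Set} (a? : Dec A) → does a? ≡ true → A
does⇒ (yes a) _ = a

least : {P : ℕ → Set} → Decidable P → ∀ n → P n → ∃[ m ] m ≤ n × P m × (∀ {k} → k < m → ¬ P k)
least P? zero p = 0 , z≤n , p , λ ()
least P? (suc n) p with P? 0
... | yes p₀ = 0 , z≤n , p₀ , λ ()
... | no ¬p₀ with m , m≤n , q , min ← least (P? ∘ suc) n p =
  suc m , s≤s m≤n , q , λ { {zero} _ → ¬p₀ ; {suc k} k<m → min (s<s⁻¹ k<m) }

-- Ramsey's theorem for finitely many 2-colourings of p-element sublists

module _ {A : Set} where

  Homogeneous : ℕ → (List A → Bool) → Bool → List A → Set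
  Homogeneous p χ b xs = ∀ {zs} → zs ⊆ xs → length zs ≡ p → χ zs ≡ b

  Homogeneous-∷ : ∀ {p χ b x xs} → Homogeneous p (χ ∘ (x ∷_)) b xs → Homogeneous (suc p) χ b xs →
                  Homogeneous (suc p) χ b (x ∷ xs)
  Homogeneous-∷ hd tl (_ ∷ʳ τ) eq = tl τ eq
  Homogeneous-∷ hd tl (refl ∷ τ) refl = hd τ refl

-- Each level pays for one head element and for a call of `R` that thins out the rest of the list
-- for it.
tower : (ℕ → ℕ) → ℕ → ℕ
tower R zero    = 0
tower R (suc k) = suc (R (tower R k))

ramseyNumber : ℕ → ℕ → ℕ
ramseyNumber zero    N = N
ramseyNumber (suc p) N = tower (ramseyNumber p) (N + N)

module _ {A : Set} where

  ramsey : ∀ p N (χ : List A → Bool) xs → ramseyNumber p N ≤ length xs →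
           ∃[ ys ] ys ⊆ xs × N ≤ length ys × ∃[ b ] Homogeneous p χ b ys

  -- Induction on `k + l`. The tail is thinned until all lists headed by `x` get one colour; in the
  -- recursive call the target length for that colour drops by one, and `x` is put back if that
  -- colour is found.
  ramsey-⊎ : ∀ p k l (χ : List A → Bool) xs → tower (ramseyNumber p) (k + l) ≤ length xs →
             (∃[ ys ] ys ⊆ xs × k ≤ length ys × Homogeneous (suc p) χ true ys) ⊎
             (∃[ ys ] ys ⊆ xs × l ≤ length ys × Homogeneous (suc p) χ false ys)

  ramsey zero N χ xs N≤ = xs , ⊆-refl , N≤ , χ [] , λ { {[]} _ _ → refl }
  ramsey (suc p) N χ xs R≤ with ramsey-⊎ p N N χ xs R≤
  ... | inj₁ (ys , τ , N≤ , hom) = ys , τ , N≤ , true , hom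
  ... | inj₂ (ys , τ , N≤ , hom) = ys , τ , N≤ , false , hom

  ramsey-⊎ p zero l χ xs _ = inj₁ ([] , minimum _ , z≤n , λ { [] () })
  ramsey-⊎ p (suc k) zero χ xs _ = inj₂ ([] , minimum _ , z≤n , λ { [] () })
  ramsey-⊎ p (suc k) (suc l) χ (x ∷ xs) (s≤s R≤)
    with ramsey p (tower (ramseyNumber p) (k + suc l)) (χ ∘ (x ∷_)) xs R≤
  ... | ys , τ , T≤ , true , hd with ramsey-⊎ p k (suc l) χ ys T≤
  ...   | inj₁ (zs , σ , k≤ , tl) =
            inj₁ (x ∷ zs , refl ∷ ⊆-trans σ τ , s≤s k≤ , Homogeneous-∷ {χ = χ} (λ ρ → hd (⊆-trans ρ σ)) tl)
  ...   | inj₂ (zs , σ , l≤ , tl) = inj₂ (zs , x ∷ʳ ⊆-trans σ τ , l≤ , tl)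
  ramsey-⊎ p (suc k) (suc l) χ (x ∷ xs) (s≤s R≤)
      | ys , τ , T≤ , false , hd
    with ramsey-⊎ p (suc k) l χ ys (subst (λ m → tower (ramseyNumber p) m ≤ length ys) (+-suc k l) T≤)
  ...   | inj₁ (zs , σ , k≤ , tl) = inj₁ (zs , x ∷ʳ ⊆-trans σ τ , k≤ , tl)
  ...   | inj₂ (zs , σ , l≤ , tl) =
            inj₂ (x ∷ zs , refl ∷ ⊆-trans σ τ , s≤s l≤ , Homogeneous-∷ {χ = χ} (λ ρ → hd (⊆-trans ρ σ)) tl)

multiRamseyNumber : {K : Set} → ℕ → List K → ℕ → ℕ
multiRamseyNumber p []       N = N
multiRamseyNumber p (_ ∷ ks) N = ramseyNumber p (multiRamseyNumber p ks N)

-- Homogeneity passes to sublists, so the colourings can be treated one after another.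
multiRamsey : {A K : Set} → ∀ p (ks : List K) N (χ : K → List A → Bool) xs → multiRamseyNumber p ks N ≤ length xs →
              ∃[ ys ] ys ⊆ xs × N ≤ length ys × All (λ k → ∃[ b ] Homogeneous p (χ k) b ys) ks
multiRamsey p [] N χ xs N≤ = xs , ⊆-refl , N≤ , []
multiRamsey p (k ∷ ks) N χ xs R≤
  with ys , τ , R′≤ , b , hom ← ramsey p (multiRamseyNumber p ks N) (χ k) xs R≤
  with zs , σ , N≤ , homs ← multiRamsey p ks N χ ys R′≤
  = zs , ⊆-trans σ τ , N≤ , (b , λ ρ → hom (⊆-trans ρ σ)) ∷ homs

-- Positions in increasing lists

-- out of range the value is 0
nth : List ℕ → ℕ → ℕ
nth []       _       = 0
nth (x ∷ xs) zero    = x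
nth (x ∷ xs) (suc a) = nth xs a

nth-All : ∀ {P : ℕ → Set} {xs a} → All P xs → a < length xs → P (nth xs a)
nth-All {a = zero}  (p ∷ _)  _        = p
nth-All {a = suc a} (_ ∷ ps) (s≤s a<) = nth-All ps a<

nth-mono : ∀ {xs a b} → AllPairs _<_ xs → a < b → b < length xs → nth xs a < nth xs b
nth-mono {a = zero}  {suc b} (x< ∷ _) _   (s≤s b<) = nth-All x< b<
nth-mono {a = suc a} {suc b} (_ ∷ <s) a<b (s≤s b<) = nth-mono <s (s<s⁻¹ a<b) b<

nth-last : ∀ xs {a} → a < length xs → nth xs a ∷ [] ⊆ drop a xs
nth-last (x ∷ xs) {zero}  _        = refl ∷ minimum _
nth-last (x ∷ xs) {suc a} (s≤s a<) = nth-last xs a<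

-- Working inside `drop a xs` allows a sublist to be assembled from its last position backwards.
nth-∷ : ∀ xs {a b zs} → a < b → nth xs b ∷ zs ⊆ drop b xs → nth xs a ∷ nth xs b ∷ zs ⊆ drop a xs
nth-∷ []       {b = suc b} a<b ()
nth-∷ (x ∷ xs) {zero}  {suc b} _   τ = refl ∷ ⊆-trans τ (drop-⊆ b xs)
nth-∷ (x ∷ xs) {suc a} {suc b} a<b τ = nth-∷ xs (s<s⁻¹ a<b) τ

AllPairs-resp-⊆ : ∀ {R : ℕ → ℕ → Set} {xs ys} → xs ⊆ ys → AllPairs R ys → AllPairs R xs
AllPairs-resp-⊆ []         []       = []
AllPairs-resp-⊆ (_ ∷ʳ τ)   (_ ∷ ps) = AllPairs-resp-⊆ τ ps
AllPairs-resp-⊆ (refl ∷ τ) (p ∷ ps) = All-resp-⊆ τ p ∷ AllPairs-resp-⊆ τ ps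

-- Walks and breadth-first search trees

module _ {G : Graph} where

  walk-end : ∀ {S : Arena G} {v u k} → Walk G S v u k → S u
  walk-end (here s)     = s
  walk-end (step _ s _) = s

  module _ {S : Arena G} (S? : Decidable S) where

    walk? : ∀ v u k → Dec (Walk G S v u k)
    walk? v u zero with v ≟F u
    ... | no v≢u = no λ { (here _) → v≢u refl }
    ... | yes refl = map′ here (λ { (here s) → s }) (S? v)
    walk? v w (suc k) =
      map′ (λ (s , _ , p , e) → step p s e) (λ { (step p s e) → s , _ , p , e })
           (S? w ×-dec any? (λ u → walk? v u k ×-dec (adj G u w ≟B true)))

    ball? : ∀ v r → Decidable (Ball G S v r)
    ball? v r u = map′ (λ (k , k<r , p) → k , s≤s⁻¹ k<r , p) (λ (k , k≤r , p) → k , s≤s k≤r , p)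
                       (anyUpTo? (walk? v u) (suc r))

  module _ (S : Fin (n G) → Bool) where

    Inside : Arena G
    Inside u = S u ≡ true

    Shortest : Fin (n G) → Fin (n G) → Set
    Shortest v u = ∃[ d ] Walk G Inside v u d × (∀ {k} → k < d → ¬ Walk G Inside v u k)

    penultimate : ∀ {v u k} → Walk G Inside v u k → Fin (n G)
    penultimate {v} (here _)     = v
    penultimate (step {u} _ _ _) = u

    -- Depth is the distance from `v`, and the parent is the last vertex but one of a shortest walk.
    bfsTree : ∀ r v → Inside v → (∀ u → Inside u → Ball G Inside v r u) → RadiusTree G r
    bfsTree r v v∈ reachable = record
      { mem       = S
      ; root      = v
      ; root∈     = v∈
      ; depth     = bfsDepth
      ; parent    = bfsParent
      ; depthRoot = depth-minimal (here v∈) λ ()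
      ; depth≤r   = λ u u∈ → let (k , k≤r , p) = reachable u u∈ in ≤-trans (depth≤ p) k≤r
      ; parentOk  = parent-ok
      }
      where
      search : ∀ u → Shortest v u ⊎ ¬ Inside u
      search u with S u ≟B true
      ... | no u∉ = inj₂ u∉
      ... | yes u∈ with k , _ , p ← reachable u u∈
                   with d , _ , q , min ← least (walk? (λ w → S w ≟B true) v u) k p = inj₁ (d , q , min)

      -- The values outside `S` are defaults; `RadiusTree` constrains members only.
      bfsDepth : Fin (n G) → ℕ
      bfsDepth u = [ proj₁ , (λ _ → 0) ]′ (search u)

      bfsParent : Fin (n G) → Fin (n G)
      bfsParent u = [ (λ (_ , p , _) → penultimate p) , (λ _ → u) ]′ (search u)

      depth≤ : ∀ {u k} → Walk G Inside v u k → bfsDepth u ≤ k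
      depth≤ {u} p with search u
      ... | inj₁ (_ , _ , min) = ≮⇒≥ λ k<d → min k<d p
      ... | inj₂ _             = z≤n

      -- The prefix of the walk found for a vertex may differ from the walk found for its parent;
      -- minimality forces equal lengths.
      depth-minimal : ∀ {u k} → Walk G Inside v u k → (∀ {l} → l < k → ¬ Walk G Inside v u l) → bfsDepth u ≡ k
      depth-minimal {u} p min with search u
      ... | inj₁ (_ , q , min′) = ≤-antisym (≮⇒≥ λ k<d → min′ k<d p) (≮⇒≥ λ d<k → min d<k q)
      ... | inj₂ u∉             = contradiction (walk-end p) u∉

      parent-ok : ∀ u → Inside u → u ≢ v →
                  Inside (bfsParent u) × Adj G u (bfsParent u) × bfsDepth u ≡ suc (bfsDepth (bfsParent u))
      parent-ok u u∈ u≢v with search u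
      ... | inj₂ u∉ = contradiction u∈ u∉
      ... | inj₁ (_ , here _ , _) = contradiction refl u≢v
      ... | inj₁ (_ , step {w} p _ e , min) =
        walk-end p , trans (adj-sym G u w) e ,
        -- A shorter walk to `w`, extended by the last edge, would undercut the shortest walk to
        -- `u`.
        cong suc (sym (depth-minimal p λ l<k q → min (s<s l<k) (step q u∈ e)))

  -- Positions are numbered from the end of the walk, and the sequence stays at
  -- the start v once it is reached.
  trail : ∀ {S : Arena G} {v u k} → Walk G S v u k → ℕ → Fin (n G)
  trail {v = v} (here _) _       = v
  trail {u = u} (step _ _ _) zero = u
  trail (step p _ _) (suc s)     = trail p s

-- Pauses are allowed, so that paths of different lengths become sequences whose positions 0 to `r`
-- can be compared.
record Trail (G : Graph) (r : ℕ) (old new : Fin (n G)) (p : ℕ → Fin (n G)) : Set where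
  field
    start : p 0 ≡ new
    end   : ∀ {s} → r ≤ s → p s ≡ old
    steps : ∀ s → p s ≡ p (suc s) ⊎ Adj G (p s) (p (suc s))

module _ {G : Graph} {S : Arena G} where

  trail-start : ∀ {v u k} (p : Walk G S v u k) → trail p 0 ≡ u
  trail-start (here _)     = refl
  trail-start (step _ _ _) = refl

  trail-end : ∀ {v u k s} (p : Walk G S v u k) → k ≤ s → trail p s ≡ v
  trail-end (here _)     _         = refl
  trail-end (step p _ _) (s≤s k≤s) = trail-end p k≤s

  trail-inside : ∀ {v u k} (p : Walk G S v u k) s → S (trail p s)
  trail-inside (here v∈)     _       = v∈
  trail-inside (step _ u∈ _) zero    = u∈
  trail-inside (step p _ _)  (suc s) = trail-inside p s

  trail-steps : ∀ {v u k} (p : Walk G S v u k) s →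
                trail p s ≡ trail p (suc s) ⊎ Adj G (trail p s) (trail p (suc s))
  trail-steps (here _) _ = inj₁ refl
  trail-steps (step {w = w} p _ e) zero = inj₂ (subst (Adj G w) (sym (trail-start p)) (trans (adj-sym G _ _) e))
  trail-steps (step p _ _) (suc s) = trail-steps p s

  trail-Trail : ∀ {r v u k} (p : Walk G S v u k) → k ≤ r → Trail G r v u (trail p)
  trail-Trail p k≤r = record
    { start = trail-start p ; end = λ r≤s → trail-end p (≤-trans k≤r r≤s) ; steps = trail-steps p }

  lazy-step : ∀ {v u w k} → Ball G S v k u → S w → u ≡ w ⊎ Adj G u w → Ball G S v (suc k) w
  lazy-step (l , l≤k , p) w∈ (inj₁ refl) = l , ≤-trans l≤k (n≤1+n _) , p
  lazy-step (l , l≤k , p) w∈ (inj₂ e)    = suc l , s≤s l≤k , step p w∈ e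

-- Homogeneous families of paths

-- Two pairs of rounds may interleave, lie one inside the other, or share the earlier round. An idle
-- fourth index pads `fork`, so that all three patterns colour quadruples.
data Pattern : Set where
  crossing nested fork : Pattern

Meets : {V : Set} → (ℕ → ℕ → ℕ → V) → Pattern → (u u′ a b c d : ℕ) → Set
Meets F crossing u u′ a b c d = F a c u ≡ F b d u′
Meets F nested   u u′ a b c d = F a d u ≡ F b c u′
Meets F fork     u u′ a b c d = F a b u ≡ F a c u′

Increasing : (a b c d M : ℕ) → Set
Increasing a b c d M = a < b × b < c × c < d × d < M

-- The first `N` indices serve as rows and the next `N + N` as the range of columns; 6 more leave
-- room for idle fourth indices and for the fixed indices 0 to 5.
module Homogenised
  (G : Graph) (r N M : ℕ) (large : N + (N + N) + 6 ≤ M)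
  (vertex : ℕ → Fin (n G)) (F : ℕ → ℕ → ℕ → Fin (n G))
  (linked : ∀ {a b} → a < b → b < M → Trail G r (vertex a) (vertex b) (F a b))
  (disjoint-paths : ∀ {a b c d} → Increasing a b c d M → ∀ s t → F a b s ≢ F c d t)
  (homogeneous : ∀ π {u u′} → u ≤ r → u′ ≤ r → ∀ {a b c d a′ b′ c′ d′} →
                 Increasing a b c d M → Increasing a′ b′ c′ d′ M →
                 Meets F π u u′ a b c d → Meets F π u u′ a′ b′ c′ d′)
  where

  small : ∀ k {k<6 : True (k <? 6)} → k < M
  small k {k<6} = <-≤-trans (toWitness k<6) (≤-trans (m≤n+m 6 (N + (N + N))) large)

  module _ {k : ℕ} (k< : k < N + (N + N)) where

    room : suc (suc k) < M
    room = ≤-trans (≤-reflexive (+-comm 3 k)) (≤-trans (+-mono-≤ (<⇒≤ k<) (s≤s (s≤s (s≤s z≤n)))) large)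

    room₁ : suc k < M
    room₁ = <-trans (n<1+n _) room

    room₀ : k < M
    room₀ = <-trans (n<1+n _) room₁

  SameSide : (i i* i′ : ℕ) → Set
  SameSide i i* i′ = (i < i′ × i* < i′) ⊎ (i′ < i × i′ < i*)

  -- Rows lie below columns, so comparing the rows and comparing the columns fixes the order of the
  -- four indices, and moving `i` to `i*` preserves it. For equal rows the successor of the larger
  -- column is the idle index of `fork`.
  shift : ∀ {u u′ j j′ i i* i′} → u ≤ r → u′ ≤ r → j < N → j′ < N → N ≤ i → N ≤ i* → N ≤ i′ →
          i < N + (N + N) → i* < N + (N + N) → i′ < N + (N + N) → SameSide i i* i′ →
          F j i u ≡ F j′ i′ u′ → F j i* u ≡ F j′ i′ u′
  shift {j = j} {j′} u≤ u′≤ j< j′< N≤i N≤i* N≤i′ i< i*< i′< side eq with <-cmp j j′ | side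
  ... | tri< j<j′ _ _ | inj₁ (l , l*) = homogeneous crossing u≤ u′≤
          (j<j′ , <-≤-trans j′< N≤i , l , room₀ i′<) (j<j′ , <-≤-trans j′< N≤i* , l* , room₀ i′<) eq
  ... | tri< j<j′ _ _ | inj₂ (g , g*) = homogeneous nested u≤ u′≤
          (j<j′ , <-≤-trans j′< N≤i′ , g , room₀ i<) (j<j′ , <-≤-trans j′< N≤i′ , g* , room₀ i*<) eq
  ... | tri> _ _ j′<j | inj₁ (l , l*) = sym (homogeneous nested u′≤ u≤
          (j′<j , <-≤-trans j< N≤i , l , room₀ i′<) (j′<j , <-≤-trans j< N≤i* , l* , room₀ i′<) (sym eq))
  ... | tri> _ _ j′<j | inj₂ (g , g*) = sym (homogeneous crossing u′≤ u≤
          (j′<j , <-≤-trans j< N≤i′ , g , room₀ i<) (j′<j , <-≤-trans j< N≤i′ , g* , room₀ i*<) (sym eq))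
  ... | tri≈ _ refl _ | inj₁ (l , l*) = homogeneous fork u≤ u′≤
          (<-≤-trans j< N≤i , l , n<1+n _ , room₁ i′<) (<-≤-trans j< N≤i* , l* , n<1+n _ , room₁ i′<) eq
  ... | tri≈ _ refl _ | inj₂ (g , g*) = sym (homogeneous fork u′≤ u≤
          (<-≤-trans j< N≤i′ , g , n<1+n _ , room₁ i<) (<-≤-trans j< N≤i′ , g* , n<1+n _ , room₁ i*<) (sym eq))

  -- By homogeneity, F a b u then depends on a only.
  Row : ℕ → Set
  Row u = F 0 1 u ≡ F 0 2 u

  0123< : Increasing 0 1 2 3 M
  0123< = s≤s z≤n , n<1+n _ , n<1+n _ , small 3

  -- Otherwise `F 0 1 0` is also `F 0 3 0`, which is `vertex 3` and lies on the path from 2 to 3,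
  -- disjoint from the path from 0 to 1.
  ¬Row-0 : ¬ Row 0
  ¬Row-0 row = disjoint-paths 0123< 0 0
    (trans (homogeneous fork z≤n z≤n 0123< (s≤s z≤n , m<n⇒m<1+n (n<1+n 1) , n<1+n _ , small 4) row)
    (trans (start (linked (s≤s z≤n) (small 3))) (sym (start (linked (n<1+n 2) (small 3))))))
    where open Trail

  Row-r : Row r
  Row-r = trans (end (linked (s≤s z≤n) (small 1)) ≤-refl) (sym (end (linked (s≤s z≤n) (small 2)) ≤-refl))
    where open Trail

  Row⇒≡ : ∀ {u a b c} → u ≤ r → Row u → a < b → a < c → b < N + (N + N) → c < N + (N + N) → F a b u ≡ F a c u
  Row⇒≡ {b = b} {c} u≤ row a<b a<c b< c< with <-cmp b c
  ... | tri< b<c _ _ = homogeneous fork u≤ u≤ 0123< (a<b , b<c , n<1+n _ , room₁ c<) row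
  ... | tri≈ _ refl _ = refl
  ... | tri> _ _ c<b = sym (homogeneous fork u≤ u≤ 0123< (a<c , c<b , n<1+n _ , room₁ b<) row)

  -- Spacing by two leaves `suc (column c)` free as an alternative place for column `c`.
  column : ℕ → ℕ
  column c = N + (c + c)

  N≤column : ∀ c → N ≤ column c
  N≤column c = m≤m+n N (c + c)

  gap : ∀ {c c′} → c < c′ → suc (column c) < column c′
  gap {c} {c′} c<c′ = ≤-trans (≤-reflexive eq) (+-monoʳ-≤ N (+-mono-≤ c<c′ c<c′))
    where
    eq : suc (suc (column c)) ≡ N + (suc c + suc c)
    eq = sym (trans (+-suc N (c + suc c)) (cong suc (trans (cong (N +_) (+-suc c c)) (+-suc N (c + c)))))

  column-gap : ∀ {c} → c < N → suc (column c) < N + (N + N)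
  column-gap = gap

  column< : ∀ {c} → c < N → column c < N + (N + N)
  column< c<N = <-trans (n<1+n _) (gap c<N)

  -- Moving `column c` to its successor would preserve the coincidence, so row `j` would have the
  -- same vertex at position `u` in both columns, which forces `Row u`. Position `u′` may be that of
  -- a tip.
  columns-apart : ∀ {u u′ j j′ c c′} → u ≤ r → u′ ≤ r → ¬ Row u → j < N → j′ < N → c < N → c′ < N → c ≢ c′ →
                  F j (column c) u ≢ F j′ (column c′) u′
  columns-apart {u} {c = c} {c′} u≤ u′≤ ¬row j< j′< c< c′< c≢c′ eq =
    ¬row (homogeneous fork u≤ u≤ (<-≤-trans j< (N≤column c) , n<1+n _ , n<1+n _ , room (column< c<)) 0123<
      (trans eq (sym (shift u≤ u′≤ j< j′< (N≤column c) (≤-trans (N≤column c) (n≤1+n _)) (N≤column c′)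
                            (column< c<) (column-gap c<) (column< c′<) side eq))))
    where
    side : SameSide (column c) (suc (column c)) (column c′)
    side with <-cmp c c′
    ... | tri< c<c′ _ _ = inj₁ (<-trans (n<1+n _) (gap c<c′) , gap c<c′)
    ... | tri≈ _ c≡c′ _ = contradiction c≡c′ c≢c′
    ... | tri> _ _ c′<c = inj₂ (<-trans (n<1+n _) (gap c′<c) , <-trans (<-trans (n<1+n _) (gap c′<c)) (n<1+n _))

  -- `Row u` moves the columns to `N` and `suc N`, where the coincidence is a crossing. By
  -- homogeneity all such crossings occur, and chaining three of them gives `F 0 2 u ≡ F 3 5 u` on
  -- disjoint paths.
  rows-apart-< : ∀ {u j j′ i i′} → u ≤ r → Row u → j < j′ → j′ < N → N ≤ i → N ≤ i′ →
                 i < N + (N + N) → i′ < N + (N + N) → F j i u ≢ F j′ i′ u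
  rows-apart-< {u} {j} {j′} u≤ row j<j′ j′<N N≤i N≤i′ i< i′< eq =
    disjoint-paths (s≤s z≤n , n<1+n _ , m<n⇒m<1+n (n<1+n _) , small 5) u u
      (trans (cross (s≤s z≤n , n<1+n _ , n<1+n _ , small 3))
      (trans (cross (n<1+n _ , n<1+n _ , n<1+n _ , small 4)) (cross (n<1+n _ , n<1+n _ , n<1+n _ , small 5))))
    where
    j<N : j < N
    j<N = <-trans j<j′ j′<N
    0<N : 0 < N
    0<N = ≤-trans (s≤s z≤n) j<N
    N< : N < N + (N + N)
    N< = ≤-trans (≤-reflexive (+-comm 1 N)) (+-monoʳ-≤ N (≤-trans 0<N (m≤m+n N N)))
    1+N< : suc N < N + (N + N)
    1+N< = ≤-trans (≤-reflexive (+-comm 2 N)) (+-monoʳ-≤ N (+-mono-≤ 0<N 0<N))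
    cross : ∀ {a b c d} → Increasing a b c d M → F a c u ≡ F b d u
    cross inc = homogeneous crossing u≤ u≤ (j<j′ , j′<N , n<1+n _ , room₁ N<) inc
      (trans (Row⇒≡ u≤ row j<N (<-≤-trans j<N N≤i) N< i<)
      (trans eq (Row⇒≡ u≤ row (<-≤-trans j′<N N≤i′) (m<n⇒m<1+n j′<N) i′< 1+N<)))

  rows-apart : ∀ {u j j′ i i′} → u ≤ r → Row u → j < N → j′ < N → j ≢ j′ → N ≤ i → N ≤ i′ →
               i < N + (N + N) → i′ < N + (N + N) → F j i u ≢ F j′ i′ u
  rows-apart {j = j} {j′} u≤ row j< j′< j≢j′ N≤i N≤i′ i< i′< eq with <-cmp j j′
  ... | tri< j<j′ _ _ = rows-apart-< u≤ row j<j′ j′< N≤i N≤i′ i< i′< eq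
  ... | tri≈ _ j≡j′ _ = j≢j′ j≡j′
  ... | tri> _ _ j′<j = rows-apart-< u≤ row j′<j j< N≤i′ N≤i i′< i< (sym eq)

  -- Branch sets of the complete minor

  completeMinor-at : ∀ t → suc t ≤ r → Row (suc t) → (∀ {u} → u < suc t → ¬ Row u) → DepthMinor r (complete N) G
  completeMinor-at t t<r row ¬row = record
    { branch   = branch
    ; disjoint = λ a b u a≢b u∈a → dec-false (member? b u) (λ u∈b → members-apart a≢b (does⇒ (member? a u) u∈a) u∈b)
    ; edges    = edge
    }
    where
    hub : Fin N → ℕ
    hub c = column (toℕ c)

    -- Here `suc t` is the `t` of the overview. The second summand is the tip of branch `c`: at
    -- position `suc t` the paths of row `c` to all columns agree.
    Member : Fin N → Fin (n G) → Set
    Member c v = (∃[ j ] j < N × ∃[ u ] u < suc t × F j (hub c) u ≡ v) ⊎ F (toℕ c) (hub c) (suc t) ≡ v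

    member? : ∀ c → Decidable (Member c)
    member? c v = anyUpTo? (λ j → anyUpTo? (λ u → F j (hub c) u ≟F v) (suc t)) N ⊎-dec (F (toℕ c) (hub c) (suc t) ≟F v)

    inBranch : Fin N → Fin (n G) → Bool
    inBranch c v = does (member? c v)

    path∈ : ∀ c {j u} → j < N → u < suc t → Inside {G} (inBranch c) (F j (hub c) u)
    path∈ c j< u< = dec-true (member? c _) (inj₁ (_ , j< , _ , u< , refl))

    tip∈ : ∀ c → Inside {G} (inBranch c) (F (toℕ c) (hub c) (suc t))
    tip∈ c = dec-true (member? c _) (inj₂ refl)

    link : ∀ c {j} → j < N → Trail G r (vertex j) (vertex (hub c)) (F j (hub c))
    link c j< = linked (<-≤-trans j< (N≤column (toℕ c))) (room₀ (column< (toℕ<n c)))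

    root-∈ : ∀ c → Inside {G} (inBranch c) (vertex (hub c))
    root-∈ c = subst (Inside {G} (inBranch c)) (Trail.start (link c (toℕ<n c))) (path∈ c (toℕ<n c) (s≤s z≤n))

    reach : ∀ c {j} → j < N → ∀ s → (∀ {s′} → s′ ≤ s → Inside {G} (inBranch c) (F j (hub c) s′)) →
            Ball G (Inside {G} (inBranch c)) (vertex (hub c)) s (F j (hub c) s)
    reach c j< zero ins = 0 , z≤n , subst (λ v → Walk G (Inside {G} (inBranch c)) (vertex (hub c)) v 0) (sym (Trail.start (link c j<))) (here (root-∈ c))
    reach c j< (suc s) ins =
      lazy-step (reach c j< s (λ s′≤ → ins (≤-trans s′≤ (n≤1+n s)))) (ins ≤-refl) (Trail.steps (link c j<) s)

    widen : ∀ {S v k w} → k ≤ r → Ball G S v k w → Ball G S v r w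
    widen k≤r (l , l≤k , p) = l , ≤-trans l≤k k≤r , p

    reachable : ∀ c v → Member c v → Ball G (Inside {G} (inBranch c)) (vertex (hub c)) r v
    reachable c _ (inj₁ (j , j< , u , u< , refl)) =
      widen (≤-trans (<⇒≤ u<) t<r) (reach c j< u (λ s′≤ → path∈ c j< (≤-<-trans s′≤ u<)))
    reachable c _ (inj₂ refl) = widen t<r (reach c (toℕ<n c) (suc t) prefix)
      where
      prefix : ∀ {s′} → s′ ≤ suc t → Inside {G} (inBranch c) (F (toℕ c) (hub c) s′)
      prefix s′≤ with m<1+n⇒m<n∨m≡n (s≤s s′≤)
      ... | inj₁ s′< = path∈ c (toℕ<n c) s′<
      ... | inj₂ refl = tip∈ c

    branch : Fin N → RadiusTree G r
    branch c = bfsTree (inBranch c) r (vertex (hub c)) (root-∈ c) (λ v v∈ → reachable c v (does⇒ (member? c v) v∈))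

    early : ∀ {u} → u < suc t → u ≤ r
    early u< = ≤-trans (<⇒≤ u<) t<r

    -- If one of the two vertices is not taken as a tip, `columns-apart` applies with it in first
    -- place; two tips lie in distinct rows.
    members-apart : ∀ {a b v} → a ≢ b → Member a v → ¬ Member b v
    members-apart {a} {b} a≢b (inj₁ (j , j< , u , u< , eq)) (inj₁ (j′ , j′< , u′ , u′< , eq′)) =
      columns-apart (early u<) (early u′<) (¬row u<) j< j′< (toℕ<n a) (toℕ<n b) (a≢b ∘ toℕ-injective) (trans eq (sym eq′))
    members-apart {a} {b} a≢b (inj₁ (j , j< , u , u< , eq)) (inj₂ eq′) =
      columns-apart (early u<) t<r (¬row u<) j< (toℕ<n b) (toℕ<n a) (toℕ<n b) (a≢b ∘ toℕ-injective) (trans eq (sym eq′))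
    members-apart {a} {b} a≢b (inj₂ eq) (inj₁ (j′ , j′< , u′ , u′< , eq′)) =
      columns-apart (early u′<) t<r (¬row u′<) j′< (toℕ<n a) (toℕ<n b) (toℕ<n a) (a≢b ∘ sym ∘ toℕ-injective) (trans eq′ (sym eq))
    members-apart {a} {b} a≢b (inj₂ eq) (inj₂ eq′) =
      rows-apart t<r row (toℕ<n a) (toℕ<n b) (a≢b ∘ toℕ-injective) (N≤column (toℕ a)) (N≤column (toℕ b))
        (column< (toℕ<n a)) (column< (toℕ<n b)) (trans eq (sym eq′))

    edge : ∀ a b → Adj (complete N) a b →
           Σ (Fin (n G)) λ u → Σ (Fin (n G)) λ w → Inside {G} (inBranch a) u × Inside {G} (inBranch b) w × Adj G u w
    -- The path from row `b` to the hub of `a` stays in branch `a` through position `t`, and its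
    -- next vertex is the tip of `b`.
    edge a b ab = F (toℕ b) (hub a) t , F (toℕ b) (hub a) (suc t) , path∈ a (toℕ<n b) (n<1+n t) ,
      subst (Inside {G} (inBranch b)) tip (tip∈ b) , adjacent
      where
      a≢b : a ≢ b
      a≢b refl with () ← trans (sym ab) (adj-irrefl (complete N) a)

      tip : F (toℕ b) (hub b) (suc t) ≡ F (toℕ b) (hub a) (suc t)
      tip = Row⇒≡ t<r row (<-≤-trans (toℕ<n b) (N≤column (toℕ b))) (<-≤-trans (toℕ<n b) (N≤column (toℕ a)))
                  (column< (toℕ<n b)) (column< (toℕ<n a))

      adjacent : Adj G (F (toℕ b) (hub a) t) (F (toℕ b) (hub a) (suc t))
      adjacent with Trail.steps (link a (toℕ<n b)) t
      ... | inj₂ e  = e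
      -- A pause would identify the vertex at position `t` in the column of `a` with the tip of `b`,
      -- across distinct columns.
      ... | inj₁ eq = contradiction (trans eq (sym tip))
                        (columns-apart (<⇒≤ t<r) t<r (¬row (n<1+n t)) (toℕ<n b) (toℕ<n b) (toℕ<n a) (toℕ<n b) (a≢b ∘ toℕ-injective))

  completeMinor : DepthMinor r (complete N) G
  completeMinor with least (λ u → F 0 1 u ≟F F 0 2 u) r Row-r
  ... | zero  , _   , row , _    = contradiction row ¬Row-0
  ... | suc t , t<r , row , ¬row = completeMinor-at t t<r row ¬row

-- The splitter game

_[_≔_] : {X : Set} → (ℕ → X) → ℕ → X → ℕ → X
(f [ i ≔ x ]) j with j ≟ i
... | yes _ = x
... | no _  = f j

module _ {X : Set} (f : ℕ → X) {x : X} where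

  ≔-hit : ∀ i → (f [ i ≔ x ]) i ≡ x
  ≔-hit i with i ≟ i
  ... | yes _  = refl
  ... | no i≢i = contradiction refl i≢i

  ≔-miss : ∀ {i j} → j < i → (f [ i ≔ x ]) j ≡ f j
  ≔-miss {i} {j} j<i with j ≟ i
  ... | yes j≡i = contradiction j≡i (<⇒≢ j<i)
  ... | no _    = refl

length-cartesianProductWith : {A B C : Set} (f : A → B → C) → ∀ xs ys →
                              length (cartesianProductWith f xs ys) ≡ length xs * length ys
length-cartesianProductWith f []       ys = refl
length-cartesianProductWith f (x ∷ xs) ys =
  trans (length-++ (map (f x) ys)) (cong₂ _+_ (length-map (f x) ys) (length-cartesianProductWith f xs ys))

-- The first i rounds of a play in which Splitter deletes, in each round b, the
-- vertices of paths from the earlier centres to the new centre; path b a joins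
-- centre a to centre b inside the arena of round a.
record History (G : Graph) (r i : ℕ) (S : Arena G) : Set where
  field
    arena?   : Decidable S
    centre   : ℕ → Fin (n G)
    path     : ℕ → ℕ → ℕ → Fin (n G)
    linked   : ∀ {a b} → a < b → b < i → Trail G r (centre a) (centre b) (path b a)
    disjoint : ∀ {a b c d} → a < b → b < c → c < d → d < i → ∀ s t → path b a s ≢ path d c t
    deleted  : ∀ {a b} → a < b → b < i → ∀ s → ¬ S (path b a s)
    reach    : ∀ {a} → a < i → ∀ {u} → S u → ∃[ p ] Trail G r (centre a) u p ×
               (∀ {x y} → x < y → y < a → ∀ s t → path y x s ≢ p t)

module _ {G : Graph} {r : ℕ} where

  emptyHistory : Fin (n G) → History G r 0 (λ _ → ⊤)
  emptyHistory v = record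
    { arena?   = λ _ → yes tt
    ; centre   = λ _ → v
    ; path     = λ _ _ _ → v
    ; linked   = λ _ ()
    ; disjoint = λ _ _ _ ()
    ; deleted  = λ _ ()
    ; reach    = λ ()
    }

  module Round {i : ℕ} {S : Arena G} (H : History G r i S) {v : Fin (n G)} (v∈ : S v) where

    open History H

    newPath : ℕ → ℕ → Fin (n G)
    newPath a with a <? i
    ... | yes a<i = proj₁ (reach a<i v∈)
    ... | no _    = λ _ → v

    newPath-Trail : ∀ {a} → a < i → Trail G r (centre a) v (newPath a)
    newPath-Trail {a} a<i with a <? i
    ... | yes a<i′ = proj₁ (proj₂ (reach a<i′ v∈))
    ... | no a≮i   = contradiction a<i a≮i

    newPath-avoids : ∀ {a x y} → a < i → x < y → y < a → ∀ s t → path y x s ≢ newPath a t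
    newPath-avoids {a} a<i with a <? i
    ... | yes a<i′ = proj₂ (proj₂ (reach a<i′ v∈))
    ... | no a≮i   = contradiction a<i a≮i

    pathVertices : List (Fin (n G))
    pathVertices = cartesianProductWith newPath (upTo i) (upTo (suc r))

    ballHere? : Decidable (Ball G S v r)
    ballHere? = ball? arena? v r

    -- The paths run through earlier, larger arenas. Only their vertices in the current ball may be
    -- deleted; the others are outside the next arena anyway.
    deletion : List (Fin (n G))
    deletion = filter ballHere? pathVertices

    deletion⊆ball : All (Ball G S v r) deletion
    deletion⊆ball = all-filter ballHere? pathVertices

    length-deletion : length deletion ≤ i * suc r
    length-deletion = ≤-trans (length-filter ballHere? pathVertices) (≤-reflexive
      (trans (length-cartesianProductWith newPath (upTo i) (upTo (suc r))) (cong₂ _*_ (length-upTo i) (length-upTo (suc r)))))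

    newPath-deleted : ∀ {a} → a < i → ∀ s → ¬ next G S v r deletion (newPath a s)
    newPath-deleted {a} a<i s (in-ball , kept) with ≤-total s r
    ... | inj₁ s≤r = kept (∈-filter⁺ ballHere? (∈-cartesianProductWith⁺ newPath (∈-upTo⁺ a<i) (∈-upTo⁺ (s≤s s≤r))) in-ball)
    -- From position `r` on the trail rests at the old centre, so position `r` stands for all later
    -- ones.
    ... | inj₂ r≤s = kept (subst (_∈ deletion) same (∈-filter⁺ ballHere?
                       (∈-cartesianProductWith⁺ newPath (∈-upTo⁺ a<i) (∈-upTo⁺ (n<1+n r)))
                       (subst (Ball G S v r) (sym same) in-ball)))
      where
      same : newPath a r ≡ newPath a s
      same = trans (Trail.end (newPath-Trail a<i) ≤-refl) (sym (Trail.end (newPath-Trail a<i) r≤s))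

    extend : History G r (suc i) (next G S v r deletion)
    extend = record
      { arena?   = λ u → ballHere? u ×-dec ¬? (_∈?_ _≟F_ u deletion)
      ; centre   = centre′
      ; path     = path′
      ; linked   = linked′
      ; disjoint = disjoint′
      ; deleted  = deleted′
      ; reach    = reach′
      }
      where
      centre′ : ℕ → Fin (n G)
      centre′ = centre [ i ≔ v ]

      path′ : ℕ → ℕ → ℕ → Fin (n G)
      path′ = path [ i ≔ newPath ]

      linked′ : ∀ {a b} → a < b → b < suc i → Trail G r (centre′ a) (centre′ b) (path′ b a)
      linked′ a<b b<1+i with m<1+n⇒m<n∨m≡n b<1+i
      ... | inj₁ b<i rewrite ≔-miss path {newPath} b<i | ≔-miss centre {v} b<i | ≔-miss centre {v} (<-trans a<b b<i) =
              linked a<b b<i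
      ... | inj₂ refl rewrite ≔-hit path {newPath} i | ≔-hit centre {v} i | ≔-miss centre {v} a<b = newPath-Trail a<b

      disjoint′ : ∀ {a b c d} → a < b → b < c → c < d → d < suc i → ∀ s t → path′ b a s ≢ path′ d c t
      disjoint′ a<b b<c c<d d<1+i with m<1+n⇒m<n∨m≡n d<1+i
      ... | inj₁ d<i rewrite ≔-miss path {newPath} d<i | ≔-miss path {newPath} (<-trans b<c (<-trans c<d d<i)) =
              disjoint a<b b<c c<d d<i
      ... | inj₂ refl rewrite ≔-hit path {newPath} i | ≔-miss path {newPath} (<-trans b<c c<d) =
              newPath-avoids c<d a<b b<c

      deleted′ : ∀ {a b} → a < b → b < suc i → ∀ s → ¬ next G S v r deletion (path′ b a s)
      deleted′ a<b b<1+i with m<1+n⇒m<n∨m≡n b<1+i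
      ... | inj₁ b<i rewrite ≔-miss path {newPath} b<i = λ { s ((_ , _ , p) , _) → deleted a<b b<i s (walk-end p) }
      ... | inj₂ refl rewrite ≔-hit path {newPath} i = newPath-deleted a<b

      -- For an old centre the trail known for the previous, larger arena is kept. For the new
      -- centre a walk within the ball stays in `S`, from which the vertices of all earlier paths
      -- have been deleted.
      reach′ : ∀ {a} → a < suc i → ∀ {u} → next G S v r deletion u → ∃[ p ] Trail G r (centre′ a) u p ×
               (∀ {x y} → x < y → y < a → ∀ s t → path′ y x s ≢ p t)
      reach′ {a} a<1+i ((k , k≤r , walk) , _) with m<1+n⇒m<n∨m≡n a<1+i
      ... | inj₁ a<i with p , isTrail , avoids ← reach a<i (walk-end walk) =
              p , subst (λ c → Trail G r c _ p) (sym (≔-miss centre a<i)) isTrail , avoids′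
        where
        avoids′ : ∀ {x y} → x < y → y < a → ∀ s t → path′ y x s ≢ p t
        avoids′ x<y y<a rewrite ≔-miss path {newPath} (<-trans y<a a<i) = avoids x<y y<a
      ... | inj₂ refl =
              trail walk , subst (λ c → Trail G r c _ (trail walk)) (sym (≔-hit centre i)) (trail-Trail walk k≤r) , avoids′
        where
        avoids′ : ∀ {x y} → x < y → y < a → ∀ s t → path′ y x s ≢ trail walk t
        avoids′ x<y y<i s t eq rewrite ≔-miss path {newPath} y<i =
          deleted x<y y<i s (subst S (sym eq) (trail-inside walk t))

-- Colouring the quadruples of rounds

patterns : List Pattern
patterns = crossing ∷ nested ∷ fork ∷ []

∈-patterns : ∀ π → π ∈ patterns
∈-patterns crossing = here refl
∈-patterns nested   = there (here refl)
∈-patterns fork     = there (there (here refl))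

colours : ℕ → List (Pattern × ℕ × ℕ)
colours r = cartesianProduct patterns (cartesianProduct (upTo (suc r)) (upTo (suc r)))

homogeneousSize : ℕ → ℕ
homogeneousSize N = N + (N + N) + 6

-- The outer `suc` guarantees a first move, which supplies the default vertex of `emptyHistory`.
rounds : ℕ → ℕ → ℕ
rounds r N = suc (multiRamseyNumber 4 (colours r) (homogeneousSize N))

deletions : ℕ → ℕ → ℕ
deletions r N = suc (rounds r N * suc r)

module _ {G : Graph} {r : ℕ} {S : Arena G} (N : ℕ) (H : History G r (rounds r N) S) where

  open History H

  -- `History` stores the later round first, so that one update adds a whole round; `F` puts the
  -- indices in order of time.
  F : ℕ → ℕ → ℕ → Fin (n G)
  F a b = path b a

  meets? : ∀ π u u′ a b c d → Dec (Meets F π u u′ a b c d)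
  meets? crossing u u′ a b c d = F a c u ≟F F b d u′
  meets? nested   u u′ a b c d = F a d u ≟F F b c u′
  meets? fork     u u′ a b c d = F a b u ≟F F a c u′

  χ : Pattern × ℕ × ℕ → List ℕ → Bool
  χ (π , u , u′) (a ∷ b ∷ c ∷ d ∷ []) = does (meets? π u u′ a b c d)
  -- A default colour: homogeneity concerns lists of length 4 only.
  χ _            _                    = false

  module _ {ys : List ℕ} (τ : ys ⊆ upTo (rounds r N)) where

    mono : ∀ {a b} → b < length ys → a < b → nth ys a < nth ys b
    mono b< a<b = nth-mono (AllPairs-resp-⊆ τ (AllPairs.applyUpTo⁺₁ id (rounds r N) λ i<j _ → i<j)) a<b b<

    bounded : ∀ {a} → a < length ys → nth ys a < rounds r N
    bounded = nth-All (All-resp-⊆ τ (all-upTo (rounds r N)))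

    module _ {M : ℕ} (M≤ : M ≤ length ys) (homs : All (λ k → ∃[ b ] Homogeneous 4 (χ k) b ys) (colours r)) where

      quadruple : ∀ {a b c d} → Increasing a b c d M → nth ys a ∷ nth ys b ∷ nth ys c ∷ nth ys d ∷ [] ⊆ ys
      quadruple {a} (a<b , b<c , c<d , d<) =
        ⊆-trans (nth-∷ ys a<b (nth-∷ ys b<c (nth-∷ ys c<d (nth-last ys (<-≤-trans d< M≤))))) (drop-⊆ a ys)

      transport : ∀ π {u u′} → u ≤ r → u′ ≤ r → ∀ {a b c d a′ b′ c′ d′} →
                  Increasing a b c d M → Increasing a′ b′ c′ d′ M →
                  Meets F π u u′ (nth ys a) (nth ys b) (nth ys c) (nth ys d) →
                  Meets F π u u′ (nth ys a′) (nth ys b′) (nth ys c′) (nth ys d′)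
      transport π u≤ u′≤ inc inc′ meets
        with b , hom ← All.lookup homs
               (∈-cartesianProduct⁺ (∈-patterns π) (∈-cartesianProduct⁺ (∈-upTo⁺ (s≤s u≤)) (∈-upTo⁺ (s≤s u′≤))))
        = does⇒ (meets? π _ _ _ _ _ _)
            (trans (hom (quadruple inc′) refl) (trans (sym (hom (quadruple inc) refl)) (dec-true (meets? π _ _ _ _ _ _) meets)))

      -- Reindexing by `nth ys` agrees with `Meets` by computation only once the pattern is a
      -- constructor, hence the three cases.
      homogeneous : ∀ π {u u′} → u ≤ r → u′ ≤ r → ∀ {a b c d a′ b′ c′ d′} →
                    Increasing a b c d M → Increasing a′ b′ c′ d′ M →
                    Meets (λ x y → F (nth ys x) (nth ys y)) π u u′ a b c d →
                    Meets (λ x y → F (nth ys x) (nth ys y)) π u u′ a′ b′ c′ d′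
      homogeneous crossing = transport crossing
      homogeneous nested   = transport nested
      homogeneous fork     = transport fork

  fullHistory⇒minor : DepthMinor r (complete N) G
  fullHistory⇒minor
    with ys , τ , M≤ , homs ← multiRamsey 4 (colours r) (homogeneousSize N) χ (upTo (rounds r N))
           (≤-trans (n≤1+n _) (≤-reflexive (sym (length-upTo (rounds r N)))))
    = Homogenised.completeMinor G r N (homogeneousSize N) ≤-refl (centre ∘ nth ys) (λ a b → F (nth ys a) (nth ys b))
        (λ a<b b< → linked (mono τ (<-≤-trans b< M≤) a<b) (bounded τ (<-≤-trans b< M≤)))
        (λ (a<b , b<c , c<d , d<) → let d<′ = <-≤-trans d< M≤ ; c<′ = <-trans c<d d<′ ; b<′ = <-trans b<c c<′ in
          disjoint (mono τ b<′ a<b) (mono τ c<′ b<c) (mono τ d<′ c<d) (bounded τ d<′))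
        (homogeneous τ M≤ homs)

-- A play through all rounds would yield a full history and hence the excluded minor. An arena
-- emptied earlier leaves Connector no move, so the remaining claim is vacuous.
minorFree⇒splitterWins : ∀ {G} r N → ¬ DepthMinor r (complete N) G → SplitterWins G (rounds r N) (deletions r N) r
minorFree⇒splitterWins {G} r N free = λ v → winsFrom (rounds r N) (emptyHistory v) refl v
  where
  winsFrom : ∀ l {i S} → History G r i S → i + l ≡ rounds r N → SplitterWinsFrom G l (deletions r N) r S
  winsFrom zero {i} {S} H eq = free (fullHistory⇒minor N (subst (λ k → History G r k S) (trans (sym (+-identityʳ i)) eq) H))
  winsFrom (suc l) {i} H eq v v∈ =
    deletion , ≤-trans length-deletion (≤-trans (*-monoˡ-≤ (suc r) i≤) (n≤1+n _)) , deletion⊆ball ,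
    inj₂ (winsFrom l extend (trans (sym (+-suc i l)) eq))
    where
    open Round H v∈
    i≤ : i ≤ rounds r N
    i≤ = ≤-trans (m≤m+n i (suc l)) (≤-reflexive eq)

-- Every graph is a subgraph of the complete graph on its vertices, so excluding `H` excludes
-- `complete (n H)`.
completeMinor⇒minor : ∀ {r G} H → DepthMinor r (complete (n H)) G → DepthMinor r H G
completeMinor⇒minor H minor = record
  { branch = branch ; disjoint = disjoint ; edges = λ a b ab → edges a b (distinct ab) }
  where
  open DepthMinor minor
  distinct : ∀ {a b} → Adj H a b → Adj (complete (n H)) a b
  distinct {a} {b} ab with a ≟F b
  ... | no _ = refl
  ... | yes refl with () ← trans (sym ab) (adj-irrefl H a)

theorem4p2 : (𝒞 : Class) →
    (NowhereDense 𝒞 → ∀ (r : ℕ) → 0 < r →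
    Σ ℕ λ ℓ → Σ ℕ λ m → (0 < ℓ) × (0 < m) × (∀ G → 𝒞 G → SplitterWins G ℓ m r))
    × (EffectivelyNowhereDense 𝒞 →
    Σ (ℕ → ℕ × ℕ) λ g → ∀ (r : ℕ) → 0 < r →
    (0 < proj₁ (g r)) × (0 < proj₂ (g r))
    × (∀ G → 𝒞 G → SplitterWins G (proj₁ (g r)) (proj₂ (g r)) r))
theorem4p2 𝒞 =
  (λ nowhereDense r _ → let (H , excluded) = nowhereDense r in
    rounds r (n H) , deletions r (n H) , s≤s z≤n , s≤s z≤n ,
    λ G G∈ → minorFree⇒splitterWins r (n H) (excluded G G∈ ∘ completeMinor⇒minor H)) ,
  (λ (f , excluded) → (λ r → rounds r (f r) , deletions r (f r)) ,
    λ r _ → s≤s z≤n , s≤s z≤n , λ G G∈ → minorFree⇒splitterWins r (f r) (excluded r G G∈))
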